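{- For every integer $k \ge 1$, $|I_k(321)|$ equals the number of parallelogram polyominoes with $k$ cells.
   Context: A permutation of length $n$ is a word $\pi=\pi_1\cdots\pi_n$ containing each of $1,\dots,n$ exactly once. The sum of permutations $\rho=\rho_1\cdots\rho_n$ and $\tau=\tau_1\cdots\tau_m$ is the permutation $\rho\oplus\tau=\rho_1\cdots\rho_n(n+\tau_1)\cdots(n+\tau_m)$ of length $n+m$. A permutation is decomposable if it equals $\rho\oplus\tau$ for some non-empty permutations $\rho,\tau$; a non-empty permutation that is not decomposable is indecomposable. An inversion of $\pi$ is a pair $(i,j)$ with $i<j$ and $\pi_i>\pi_j$. A permutation $\pi$ contains a permutation (pattern) $\tau=\tau_1\cdots\tau_m$ if there are indices $i_1<\dots<i_m$ such that $\pi_{i_1},\dots,\pi_{i_m}$ is order-isomorphic to $\tau_1,\dots,\tau_m$; otherwise $\pi$ avoids $\tau$. $I_k(\tau_1,\dots,\tau_r)$ denotes the (finite) set of all indecomposable permutations, of any length, with exactly $k$ inversions that avoid all of $\tau_1,\dots,\tau_r$. A parallelogram polyomino is a pair of weakly increasing sequences of non-negative integers $(\ell_1,\dots,\ell_n)$ and $(r_1,\dots,r_n)$, for some $n\ge 1$, such that $\ell_1=0$, $\ell_i<r_i$ for all $1\le i\le n$, and $\ell_{i+1}<r_i$ for all $1\le i<n$. It is viewed as the union of the unit cells in the segment $[\ell_i,r_i]$ at height $i$, so its number of cells is $\sum_{i=1}^n (r_i-\ell_i)$. -}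

module Defs where

open import Data.Fin as Fin using (Fin; zero; suc; inject₁)
open import Data.List as List
  using (List; []; _++_; length; map; filter; allFin; applyUpTo; cartesianProduct)
open import Data.List.Membership.Propositional using (_∈_)
open import Data.List.Relation.Binary.Permutation.Propositional using (_↭_)
open import Data.List.Relation.Unary.All using (All)
open import Data.List.Relation.Unary.Unique.Propositional using (Unique)
open import Data.Nat using (ℕ; suc; _+_; _∸_; _≤_; _<_)
import Data.Fin.Properties as Fin
import Data.Nat.Properties as ℕ
open import Data.Product using (Σ-syntax; ∃-syntax; _×_; _,_)
open import Data.Vec as Vec using (Vec)
open import Function using (_⇔_)
open import Level using (Level; 0ℓ)
open import Relation.Binary.PropositionalEquality using (_≡_; _≢_)
open import Relation.Nullary using (¬_; Dec)
open import Relation.Nullary.Decidable using (_×-dec_)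
open import Relation.Unary using (Pred)

private
  variable
    a p : Level

-- The subset P of A is finite with exactly N elements: some repetition-free
-- list of length N has precisely the elements of P as its members.
_HasSize_ : {A : Set a} → Pred A p → ℕ → Set _
_HasSize_ {A = A} P N =
  Σ[ xs ∈ List A ] Unique xs × (∀ x → x ∈ xs ⇔ P x) × length xs ≡ N

-- Permutations are words with entries 1, …, n; positions in a word are
-- elements of Fin n and hence counted from 0.
Word : Set
Word = List ℕ

IsPermutation : Pred Word 0ℓ
IsPermutation π = π ↭ applyUpTo suc (length π)

_⊕_ : Word → Word → Word
ρ ⊕ τ = ρ ++ map (length ρ +_) τ

Decomposable : Pred Word 0ℓ
Decomposable π =
  ∃[ ρ ] ∃[ τ ] IsPermutation ρ × IsPermutation τ × ρ ≢ [] × τ ≢ [] × π ≡ ρ ⊕ τ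

Indecomposable : Pred Word 0ℓ
Indecomposable π = π ≢ [] × ¬ Decomposable π

Inversion : (π : Word) → Pred (Fin (length π) × Fin (length π)) 0ℓ
Inversion π (i , j) = i Fin.< j × List.lookup π j < List.lookup π i

inversion? : (π : Word) (ij : Fin (length π) × Fin (length π)) → Dec (Inversion π ij)
inversion? π (i , j) = (i Fin.<? j) ×-dec (List.lookup π j ℕ.<? List.lookup π i)

inversions : Word → ℕ
inversions π =
  length (filter (inversion? π) (cartesianProduct (allFin (length π)) (allFin (length π))))

_Contains_ : Word → Word → Set
π Contains τ =
  Σ[ ι ∈ (Fin (length τ) → Fin (length π)) ]
    (∀ {i j} → i Fin.< j → ι i Fin.< ι j) ×
    (∀ i j → List.lookup τ i < List.lookup τ j ⇔
             List.lookup π (ι i) < List.lookup π (ι j))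

_Avoids_ : Word → Word → Set
π Avoids τ = ¬ (π Contains τ)

I : ℕ → List Word → Pred Word 0ℓ
I k τs π =
  IsPermutation π × Indecomposable π × inversions π ≡ k × All (π Avoids_) τs

WeaklyIncreasing : ∀ {n} → Pred (Vec ℕ n) 0ℓ
WeaklyIncreasing v = ∀ {i j} → i Fin.≤ j → Vec.lookup v i ≤ Vec.lookup v j

-- The sequences (ℓ₁, …, ℓₙ) and (r₁, …, rₙ), with n = suc m to force n ≥ 1.
Boundaries : Set
Boundaries = Σ[ m ∈ ℕ ] Vec ℕ (suc m) × Vec ℕ (suc m)

record IsParallelogramPolyomino {m} (ℓ r : Vec ℕ (suc m)) : Set where
  field
    ℓ-increasing : WeaklyIncreasing ℓ
    r-increasing : WeaklyIncreasing r
    ℓ-start      : Vec.lookup ℓ zero ≡ 0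
    rows         : (i : Fin (suc m)) → Vec.lookup ℓ i < Vec.lookup r i
    contact      : (i : Fin m) → Vec.lookup ℓ (suc i) < Vec.lookup r (inject₁ i)

-- Truncated subtraction is exact on polyominoes, where ℓᵢ < rᵢ.
cells : Boundaries → ℕ
cells (_ , ℓ , r) = Vec.sum (Vec.zipWith _∸_ r ℓ)

ParallelogramPolyomino : ℕ → Pred Boundaries 0ℓ
ParallelogramPolyomino k b@(_ , ℓ , r) = IsParallelogramPolyomino ℓ r × cells b ≡ k

{-# OPTIONS --safe #-}
module Submission where

-- Read a 321-avoiding permutation from left to right, and call a value pending
-- when it is smaller than some entry already read but has not yet been read.
-- Avoiding 321 means that the pending values turn up in increasing order, so
-- each entry is either the smallest pending value, or a new maximum, described
-- by the number a of unread values that it skips and thereby makes pending.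
-- Being indecomposable means that the number d of pending values is positive
-- until the very end.  A new maximum is the larger entry of exactly as many
-- inversions as there are values pending just after it, and an entry of the
-- first kind is the larger entry of none.
--
-- The same data describe a parallelogram polyomino from bottom to top: maintain
-- a segment [l, r] of width d = r - l; a smallest pending value moves the left
-- end by one, and a new maximum moves the right end by a and lays down the
-- current segment as a row.  Positivity of d is the condition that consecutive
-- rows share a cell side, and the area of a row is the width d at that moment.
--
-- Both descriptions are made precise through the type Walk d of histories that
-- start with d pending values.  Both start with d = 1, the permutation with the
-- value 1 pending and the polyomino with the segment [0, 1].  The map
-- permutation is a bijection from the walks of area k in Walk 1 onto I_k(321)
-- (word-injective, word-surjective, word-inversionCount), and the map boundaries
-- is a bijection from the same walks onto the polyominoes with k cells
-- (outline-injective, outline-surjective, outline-cells).  For k = 0 the second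
-- one fails: the only walk of area 0 gives the permutation 1, but no polyomino.
-- Finally, the walks of a given area can be listed (walksOfArea-finite).

open import Defs
open import Data.List using ([]; _∷_)
open import Data.Nat using (ℕ; _≥_)
open import Data.Product using (∃-syntax; _×_)

open import Data.Fin using (Fin; zero; suc; inject₁)
import Data.Fin as Fin
open import Data.List as List
  using (List; _++_; [_]; length; map; filter; allFin; applyUpTo; upTo; concatMap; cartesianProduct)
open import Data.List.Membership.Propositional using (_∈_)
open import Data.List.Membership.Propositional.Properties
  using (∈-map⁺; ∈-map⁻; ∈-++⁺ˡ; ∈-++⁺ʳ; ∈-++⁻; ∈-filter⁺; ∈-filter⁻;
         ∈-concatMap⁺; ∈-concatMap⁻; ∈-upTo⁺; ∈-lookup)
import Data.List.Properties as List
open import Data.List.Relation.Binary.Disjoint.Propositional using (Disjoint)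
open import Data.List.Relation.Binary.Permutation.Propositional
  using (_↭_; ↭-sym; ↭-trans; ↭-reflexive; prep; ↭⇒↭ₛ; module PermutationReasoning)
import Data.List.Relation.Binary.Permutation.Propositional.Properties as ↭
import Data.List.Relation.Binary.Permutation.Setoid.Properties as ↭ₛ
open import Data.List.Relation.Unary.All as All using (All; []; _∷_)
import Data.List.Relation.Unary.All.Properties as All
open import Data.List.Relation.Unary.AllPairs as AllPairs using (AllPairs; []; _∷_)
import Data.List.Relation.Unary.AllPairs.Properties as AllPairs
open import Data.List.Relation.Unary.Any as Any using (Any; here; there)
open import Data.List.Relation.Unary.Unique.Propositional using (Unique)
import Data.List.Relation.Unary.Unique.Propositional.Properties as Unique
open import Data.Nat using (zero; suc; _+_; _∸_; _⊔_; _≤_; _<_; z≤n; s≤s; s<s; z<s; _<?_; _≟_)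
open import Data.Nat.Properties
open import Data.Product using (Σ-syntax; _,_; proj₂)
open import Data.Sum using (inj₁; inj₂)
open import Data.Unit using (⊤; tt)
open import Data.Vec as Vec using (Vec; []; _∷_; toList)
import Data.Vec.Properties as Vec
open import Function using (_∘_; _⇔_; mk⇔; Equivalence; id)
open import Level using (Level)
open import Relation.Binary.PropositionalEquality
  using (_≡_; _≢_; refl; sym; trans; setoid; cong; cong₂; subst; subst₂; module ≡-Reasoning)
open import Relation.Nullary using (¬_; yes; no; contradiction)
open import Relation.Unary using (Pred; Decidable)
open import Relation.Unary.Properties using (∁?)

private
  variable
    a p q : Level
    A B : Set a
    d m n l r : ℕ

-- Walks and their enumeration

-- A walk from d pending values: done ends it, low reads the smallest pending
-- value, and high a reads a new maximum that makes a further values pending.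
-- The indices let a walk end only with nothing pending, and forbid a new maximum
-- when nothing is pending.
data Walk : ℕ → Set where
  done : Walk 0
  low  : Walk d → Walk (suc d)
  high : ∀ a → Walk (suc d + a) → Walk (suc d)

-- The number of pending values after each new maximum, summed.
area : Walk d → ℕ
area done             = 0
area (low w)          = area w
area (high {d} a w) = (suc d + a) + area w

low-injective : {w w′ : Walk d} → low w ≡ low w′ → w ≡ w′
low-injective refl = refl

high-injective : ∀ {a} {w w′ : Walk (suc d + a)} → high a w ≡ high a w′ → w ≡ w′
high-injective refl = refl

-- All walks from d with at most n new maxima, the bounds on the skips being large
-- enough to include every walk of area at most n; highs n d lists those walks from
-- suc d that begin with a new maximum.
walks : ℕ → ∀ d → List (Walk d)
highs : ℕ → ∀ d → List (Walk (suc d))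

walks n zero    = done ∷ []
walks n (suc d) = map low (walks n d) ++ highs n d

highs zero    d = []
highs (suc n) d = concatMap (λ a → map (high a) (walks n (suc d + a))) (upTo (suc n))

∈-walks : ∀ n (w : Walk d) → area w ≤ n → w ∈ walks n d
∈-highs : ∀ n a (w : Walk (suc d + a)) → area (high a w) ≤ n → high a w ∈ highs n d

∈-walks n done           _   = here refl
∈-walks n (low w)        w≤n = ∈-++⁺ˡ (∈-map⁺ low (∈-walks n w w≤n))
∈-walks n (high {d} a w) w≤n = ∈-++⁺ʳ (map low (walks n d)) (∈-highs n a w w≤n)

∈-highs {d} (suc n) a w (s≤s w≤n) = ∈-concatMap⁺ _ (Any.map
  (λ { refl → ∈-map⁺ (high a) (∈-walks n w (≤-trans (m≤n+m _ (d + a)) w≤n)) })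
  (∈-upTo⁺ (s≤s (≤-trans (m≤n+m a d) (m+n≤o⇒m≤o (d + a) w≤n)))))

∈-highs⁻ : ∀ n {x : Walk (suc d)} → x ∈ highs n d →
           ∃[ a ] Σ[ w ∈ Walk (suc d + a) ] x ≡ high a w
∈-highs⁻ (suc n) x∈ with Any.satisfied (∈-concatMap⁻ _ {xs = upTo (suc n)} x∈)
... | a , x∈a with ∈-map⁻ (high a) x∈a
... | w , _ , eq = a , w , eq

walks-unique : ∀ n d → Unique (walks n d)
highs-unique : ∀ n d → Unique (highs n d)

walks-unique n zero    = [] ∷ []
walks-unique n (suc d) = Unique.++⁺
  (Unique.map⁺ low-injective (walks-unique n d)) (highs-unique n d) disjoint
  where
  disjoint : Disjoint (map low (walks n d)) (highs n d)
  disjoint (x∈l , x∈h) with ∈-map⁻ low x∈l | ∈-highs⁻ n x∈h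
  ... | _ , _ , refl | _ , _ , ()

highs-unique zero    d = []
highs-unique (suc n) d = Unique.concat⁺
  (All.map⁺ (All.universal
    (λ a → Unique.map⁺ high-injective (walks-unique n (suc d + a))) (upTo (suc n))))
  (AllPairs.map⁺ (AllPairs.map disjoint (Unique.upTo⁺ (suc n))))
  where
  disjoint : ∀ {a b} → a ≢ b →
    Disjoint (map (high a) (walks n (suc d + a))) (map (high b) (walks n (suc d + b)))
  disjoint {a} {b} a≢b (x∈a , x∈b) with ∈-map⁻ (high a) x∈a | ∈-map⁻ (high b) x∈b
  ... | _ , _ , refl | _ , _ , refl = a≢b refl

WalkOfArea : ∀ d → ℕ → Pred (Walk d) _
WalkOfArea d k w = area w ≡ k

walksOfArea-finite : ∀ d k → ∃[ N ] (WalkOfArea d k HasSize N)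
walksOfArea-finite d k =
  _ , filter area≟ (walks k d) , Unique.filter⁺ area≟ (walks-unique k d)
    , (λ w → mk⇔ (proj₂ ∘ ∈-filter⁻ area≟ {xs = walks k d})
                 (λ w≡k → ∈-filter⁺ area≟ (∈-walks k w (≤-reflexive w≡k)) w≡k))
    , refl
  where
  area≟ : Decidable (WalkOfArea d k)
  area≟ w = area w ≟ k

-- Transporting a cardinality along a bijection of predicates

-- Injectivity of f is needed only between elements satisfying P.
map-unique : {P : Pred A p} (f : A → B) →
  (∀ {x y} → P x → P y → f x ≡ f y → x ≡ y) →
  ∀ {xs} → All P xs → Unique xs → Unique (map f xs)
map-unique f inj []         []            = []
map-unique f inj (px ∷ pxs) (x∉xs ∷ uxs) =
  All.map⁺ (All.zipWith (λ { (py , x≢y) → x≢y ∘ inj px py }) (pxs , x∉xs)) ∷ map-unique f inj pxs uxs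

HasSize-bijection : {P : Pred A p} {Q : Pred B q} {n : ℕ} (f : A → B) →
  (∀ x → P x → Q (f x)) →
  (∀ x y → P x → P y → f x ≡ f y → x ≡ y) →
  (∀ y → Q y → Σ[ x ∈ A ] P x × f x ≡ y) →
  P HasSize n → Q HasSize n
HasSize-bijection {P = P} {Q} f to inj sur (xs , unique , xs⇔P , len) =
  map f xs
  , map-unique f (inj _ _) (All.tabulate (Equivalence.to (xs⇔P _))) unique
  , (λ y → mk⇔ (sound y) (complete y))
  , trans (List.length-map f xs) len
  where
  sound : ∀ y → y ∈ map f xs → Q y
  sound y y∈ with ∈-map⁻ f y∈
  ... | x , x∈ , refl = to x (Equivalence.to (xs⇔P x) x∈)

  complete : ∀ y → Q y → y ∈ map f xs
  complete y qy with sur y qy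
  ... | x , px , refl = ∈-map⁺ f (Equivalence.from (xs⇔P x) px)

-- Parallelogram polyominoes

-- The left and right ends of the rows, listed from the bottom to the top.
Rows : Set
Rows = Σ[ n ∈ ℕ ] Vec ℕ n × Vec ℕ n

-- Insert a row [l, r] below all others.
addRow : ℕ → ℕ → Rows → Rows
addRow l r (n , L , R) = suc n , l ∷ L , r ∷ R

-- The rows laid down by a walk from the segment [l, l + d].
outline : ℕ → Walk d → Rows
outline l done             = 0 , [] , []
outline l (low w)          = outline (suc l) w
outline l (high {d} a w) = addRow l (l + (suc d + a)) (outline l w)

-- The rows L, R can be put on top of the row [l, r] of a polyomino.  That each
-- of them is non-empty, l′ < r′, follows from l′ < r and r ≤ r′.
data Stacked : ℕ → ℕ → Vec ℕ n → Vec ℕ n → Set where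
  []  : Stacked l r [] []
  row : ∀ {l′ r′} {L R : Vec ℕ n} → l ≤ l′ → l′ < r → r ≤ r′ →
        Stacked l′ r′ L R → Stacked l r (l′ ∷ L) (r′ ∷ R)

Stacked-weaken : ∀ {l₁ l₂ r} {L R : Vec ℕ n} → l₁ ≤ l₂ → Stacked l₂ r L R → Stacked l₁ r L R
Stacked-weaken l₁≤l₂ []                  = []
Stacked-weaken l₁≤l₂ (row l≤ <r r≤ rows) = row (≤-trans l₁≤l₂ l≤) <r r≤ rows

Stacked-cast : ∀ {r′} {L R : Vec ℕ n} → r ≡ r′ → Stacked l r L R → Stacked l r′ L R
Stacked-cast refl s = s

outline-stacked : ∀ l (w : Walk d) → let (_ , L , R) = outline l w in Stacked l (l + d) L R
outline-stacked l done = []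
outline-stacked l (low {d} w) =
  Stacked-weaken (n≤1+n l) (Stacked-cast (sym (+-suc l d)) (outline-stacked (suc l) w))
outline-stacked l (high {d} a w) =
  row ≤-refl (m<m+n l z<s) (+-monoʳ-≤ l (m≤m+n (suc d) a)) (outline-stacked l w)

outline-cells : ∀ l (w : Walk d) →
  let (_ , L , R) = outline l w in Vec.sum (Vec.zipWith _∸_ R L) ≡ area w
outline-cells l done             = refl
outline-cells l (low w)          = outline-cells (suc l) w
outline-cells l (high {d} a w) = cong₂ _+_ (m+n∸m≡n l (suc d + a)) (outline-cells l w)

addRow-injective : ∀ {l l′ r r′ b b′} → addRow l r b ≡ addRow l′ r′ b′ → r ≡ r′ × b ≡ b′
addRow-injective refl = refl , refl

-- Once the left end has moved past l, no later row starts at l.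
outline-suc≢addRow : ∀ l (w : Walk d) {r b} → outline (suc l) w ≢ addRow l r b
outline-suc≢addRow l w eq with outline (suc l) w | outline-stacked (suc l) w
outline-suc≢addRow l w refl | _ | row l<l _ _ _ = n≮n l l<l

outline-injective : ∀ l (w w′ : Walk d) → outline l w ≡ outline l w′ → w ≡ w′
outline-injective l done       done        eq = refl
outline-injective l (low w)    (low w′)    eq = cong low (outline-injective (suc l) w w′ eq)
outline-injective l (low w)    (high a w′) eq = contradiction eq (outline-suc≢addRow l w)
outline-injective l (high a w) (low w′)    eq = contradiction (sym eq) (outline-suc≢addRow l w′)
outline-injective l (high {d} a w) (high b w′) eq with addRow-injective eq
... | r≡r′ , rest≡ with +-cancelˡ-≡ (suc d) a b (+-cancelˡ-≡ l _ _ r≡r′)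
... | refl = cong (high a) (outline-injective l w w′ rest≡)

+-regroup : ∀ l j c a → l + (j + c) + a ≡ l + j + (c + a)
+-regroup l j c a = trans (cong (_+ a) (sym (+-assoc l j c))) (+-assoc (l + j) c a)

-- The walk that reads j smallest pending values before it goes on as given.
lows : ∀ j → Walk d → Walk (j + d)
lows zero    w = w
lows (suc j) w = low (lows j w)

outline-lows : ∀ l j (w : Walk d) → outline l (lows j w) ≡ outline (l + j) w
outline-lows l zero    w rewrite +-identityʳ l = refl
outline-lows l (suc j) w rewrite +-suc l j = outline-lows (suc l) j w

outline-surjective : ∀ l d {L R : Vec ℕ n} → Stacked l (l + d) L R →
  Σ[ w ∈ Walk d ] outline l w ≡ (n , L , R)
outline-surjective l d [] =
  subst (λ d → Σ[ w ∈ Walk d ] outline l w ≡ _) (+-identityʳ d) (lows d done , outline-lows l d done)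
-- The next row is reached by moving the left end by j, which leaves a segment of
-- width suc e, and then the right end by a.
outline-surjective l d (row l≤l′ l′<r r≤r′ s)
  with m≤n⇒∃[o]m+o≡n l≤l′ | m≤n⇒∃[o]m+o≡n l′<r | m≤n⇒∃[o]m+o≡n r≤r′
... | j , refl | e , l′<r≡ | a , refl
  with +-cancelˡ-≡ l (j + suc e) d
         (trans (sym (+-assoc l j (suc e))) (trans (+-suc (l + j) e) l′<r≡))
... | refl
  with outline-surjective (l + j) (suc e + a) (Stacked-cast (+-regroup l j (suc e) a) s)
... | w , eq = lows j (high a w) ,
  trans (outline-lows l j (high a w))
        (cong₂ (addRow (l + j)) (sym (+-regroup l j (suc e) a)) eq)

Stacked⇒l≤ : {L R : Vec ℕ n} → Stacked l r L R → ∀ i → l ≤ Vec.lookup L i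
Stacked⇒l≤ (row l≤ _ _ s) zero    = l≤
Stacked⇒l≤ (row l≤ _ _ s) (suc i) = ≤-trans l≤ (Stacked⇒l≤ s i)

Stacked⇒r≤ : {L R : Vec ℕ n} → Stacked l r L R → ∀ i → r ≤ Vec.lookup R i
Stacked⇒r≤ (row _ _ r≤ s) zero    = r≤
Stacked⇒r≤ (row _ _ r≤ s) (suc i) = ≤-trans r≤ (Stacked⇒r≤ s i)

Stacked⇒ℓ-increasing : {L R : Vec ℕ n} → Stacked l r L R → WeaklyIncreasing L
Stacked⇒ℓ-increasing (row _ _ _ s) {zero}  {zero}  _         = ≤-refl
Stacked⇒ℓ-increasing (row _ _ _ s) {zero}  {suc j} _         = Stacked⇒l≤ s j
Stacked⇒ℓ-increasing (row _ _ _ s) {suc i} {suc j} (s≤s i≤j) = Stacked⇒ℓ-increasing s i≤j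

Stacked⇒r-increasing : {L R : Vec ℕ n} → Stacked l r L R → WeaklyIncreasing R
Stacked⇒r-increasing (row _ _ _ s) {zero}  {zero}  _         = ≤-refl
Stacked⇒r-increasing (row _ _ _ s) {zero}  {suc j} _         = Stacked⇒r≤ s j
Stacked⇒r-increasing (row _ _ _ s) {suc i} {suc j} (s≤s i≤j) = Stacked⇒r-increasing s i≤j

Stacked⇒rows : {L R : Vec ℕ n} → Stacked l r L R → ∀ i → Vec.lookup L i < Vec.lookup R i
Stacked⇒rows (row _ <r r≤ s) zero    = <-≤-trans <r r≤
Stacked⇒rows (row _ _ _ s)   (suc i) = Stacked⇒rows s i

Stacked⇒contact : {L R : Vec ℕ (suc m)} → Stacked l r L R →
  (i : Fin m) → Vec.lookup L (suc i) < Vec.lookup R (inject₁ i)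
Stacked⇒contact (row _ _ _ (row _ <r _ _)) zero    = <r
Stacked⇒contact (row _ _ _ s@(row _ _ _ _)) (suc i) = Stacked⇒contact s i

Stacked⇒IsParallelogramPolyomino : {L R : Vec ℕ (suc m)} →
  Stacked 0 1 L R → IsParallelogramPolyomino L R
Stacked⇒IsParallelogramPolyomino s@(row _ l<1 _ _) = record
  { ℓ-increasing = Stacked⇒ℓ-increasing s
  ; r-increasing = Stacked⇒r-increasing s
  ; ℓ-start      = n<1⇒n≡0 l<1
  ; rows         = Stacked⇒rows s
  ; contact      = Stacked⇒contact s
  }

-- The converse of the preceding lemmas, by recursion on the number of rows.
stack : (L R : Vec ℕ (suc m)) →
  l ≤ Vec.head L → Vec.head L < r → r ≤ Vec.head R →
  WeaklyIncreasing L → WeaklyIncreasing R →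
  ((i : Fin m) → Vec.lookup L (suc i) < Vec.lookup R (inject₁ i)) →
  Stacked l r L R
stack (_ ∷ [])        (_ ∷ [])        l≤ <r r≤ _    _    _       = row l≤ <r r≤ []
stack (_ ∷ L@(_ ∷ _)) (_ ∷ R@(_ ∷ _)) l≤ <r r≤ incL incR contact =
  row l≤ <r r≤ (stack L R (incL {zero} {suc zero} z≤n) (contact zero) (incR {zero} {suc zero} z≤n)
    (λ {i} {j} i≤j → incL {suc i} {suc j} (s≤s i≤j))
    (λ {i} {j} i≤j → incR {suc i} {suc j} (s≤s i≤j))
    (contact ∘ suc))

IsParallelogramPolyomino⇒Stacked : {L R : Vec ℕ (suc m)} →
  IsParallelogramPolyomino L R → Stacked 0 1 L R
IsParallelogramPolyomino⇒Stacked {L = _ ∷ _} {R = _ ∷ _} P =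
  stack _ _ z≤n (s≤s (≤-reflexive ℓ-start)) (≤-trans (s≤s z≤n) (rows zero))
    (λ {i} {j} → ℓ-increasing {i} {j}) (λ {i} {j} → r-increasing {i} {j}) contact
  where open IsParallelogramPolyomino P

-- Only polyominoes with at least one row are represented in Boundaries; the
-- value chosen for no rows is not a polyomino.
toBoundaries : Rows → Boundaries
toBoundaries (zero  , _)     = 0 , 0 ∷ [] , 0 ∷ []
toBoundaries (suc m , L , R) = m , L , R

toBoundaries-injective : ∀ {m m′ L R L′ R′} →
  toBoundaries (suc m , L , R) ≡ toBoundaries (suc m′ , L′ , R′) →
  _≡_ {A = Rows} (suc m , L , R) (suc m′ , L′ , R′)
toBoundaries-injective refl = refl

-- The polyomino that a walk lays down, starting from the segment [0, 1].
boundaries : Walk 1 → Boundaries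
boundaries = toBoundaries ∘ outline 0

polyominoes-finite : ∀ {N} k → k ≥ 1 → WalkOfArea 1 k HasSize N → ParallelogramPolyomino k HasSize N
polyominoes-finite k k≥1 = HasSize-bijection boundaries to injective surjective
  where
  to : ∀ w → WalkOfArea 1 k w → ParallelogramPolyomino k (boundaries w)
  to (low done)   refl = contradiction k≥1 (n≮n 0)
  to w@(high _ _) refl = Stacked⇒IsParallelogramPolyomino (outline-stacked 0 w) , outline-cells 0 w

  injective : ∀ w w′ → WalkOfArea 1 k w → WalkOfArea 1 k w′ → boundaries w ≡ boundaries w′ → w ≡ w′
  injective (low done) _ refl _ _ = contradiction k≥1 (n≮n 0)
  injective (high _ _) (low done) _ refl _ = contradiction k≥1 (n≮n 0)
  injective w@(high _ _) w′@(high _ _) _ _ eq = outline-injective 0 w w′ (toBoundaries-injective eq)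

  surjective : ∀ b → ParallelogramPolyomino k b → Σ[ w ∈ Walk 1 ] WalkOfArea 1 k w × boundaries w ≡ b
  surjective (m , L , R) (polyomino , cells≡k)
    with outline-surjective 0 1 (IsParallelogramPolyomino⇒Stacked polyomino)
  ... | w , eq = w
    , trans (sym (outline-cells 0 w))
        (trans (cong (λ (_ , L , R) → Vec.sum (Vec.zipWith _∸_ R L)) eq) cells≡k)
    , cong toBoundaries eq

-- Words of walks

-- The values m, m + 1, …, m + n - 1.
fresh : ℕ → ∀ n → Vec ℕ n
fresh m zero    = []
fresh m (suc n) = m ∷ fresh (suc m) n

interval : ℕ → ℕ → List ℕ
interval m n = toList (fresh m n)

interval-++ : ∀ m a n → interval m (a + n) ≡ interval m a ++ interval (m + a) n
interval-++ m zero    n rewrite +-identityʳ m = refl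
interval-++ m (suc a) n rewrite +-suc m a = cong (m ∷_) (interval-++ (suc m) a n)

interval-lower : ∀ m n → All (m ≤_) (interval m n)
interval-lower m zero    = []
interval-lower m (suc n) = ≤-refl ∷ All.map <⇒≤ (interval-lower (suc m) n)

interval-upper : ∀ m n → All (_< m + n) (interval m n)
interval-upper m zero    = []
interval-upper m (suc n) rewrite +-suc m n = s≤s (m≤m+n m n) ∷ interval-upper (suc m) n

interval-sorted : ∀ m n → AllPairs _<_ (interval m n)
interval-sorted m zero    = []
interval-sorted m (suc n) = interval-lower (suc m) n ∷ interval-sorted (suc m) n

∈-interval⁻ : ∀ m n {x} → x ∈ interval m n → ∃[ a ] ∃[ b ] x ≡ m + a × n ≡ a + suc b
∈-interval⁻ m (suc n) (here refl) = 0 , n , sym (+-identityʳ m) , refl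
∈-interval⁻ m (suc n) (there x∈) with ∈-interval⁻ (suc m) n x∈
... | a , b , x≡ , n≡ = suc a , b , trans x≡ (sym (+-suc m a)) , cong suc n≡

interval-applyUpTo : ∀ m n (f : ℕ → ℕ) → (∀ i → f i ≡ m + i) → interval m n ≡ applyUpTo f n
interval-applyUpTo m zero    f f≗ = refl
interval-applyUpTo m (suc n) f f≗ = cong₂ _∷_ (trans (sym (+-identityʳ m)) (sym (f≗ 0)))
  (interval-applyUpTo (suc m) n (f ∘ suc) (λ i → trans (f≗ (suc i)) (+-suc m i)))

interval-map : ∀ c m n → interval (c + m) n ≡ map (c +_) (interval m n)
interval-map c m zero    = refl
interval-map c m (suc n) = cong (c + m ∷_)
  (trans (cong (λ k → interval k n) (sym (+-suc c m))) (interval-map c (suc m) n))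

length-interval : ∀ m n → length (interval m n) ≡ n
length-interval m n = Vec.length-toList (fresh m n)

IsPermutation⇒↭interval : ∀ {π} → IsPermutation π → π ↭ interval 1 (length π)
IsPermutation⇒↭interval {π} p = ↭-trans p (↭-reflexive (sym (interval-applyUpTo 1 (length π) suc λ _ → refl)))

↭interval⇒IsPermutation : ∀ {π n} → π ↭ interval 1 n → IsPermutation π
↭interval⇒IsPermutation {π} {n} p
  rewrite trans (↭.↭-length p) (length-interval 1 n) =
  ↭-trans p (↭-reflexive (interval-applyUpTo 1 n suc λ _ → refl))

-- The invariant of the reading: U lists the pending values in increasing order,
-- and they are less than m, the first value neither read nor skipped.
record Pending (m : ℕ) (U : Vec ℕ d) : Set where
  constructor pending
  field
    bounded : All (_< m) (toList U)
    sorted  : AllPairs _≤_ (toList U)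
open Pending

Pending-low : ∀ {u} {U : Vec ℕ d} → Pending m (u ∷ U) → Pending m U
Pending-low (pending (_ ∷ b) (_ ∷ s)) = pending b s

Pending-++ : ∀ {U : Vec ℕ d} → Pending m U → ∀ a → Pending (m + a) (U Vec.++ fresh m a)
Pending-++ {m = m} {U} (pending b s) a = pending
  (subst (All (_< m + a)) (sym (Vec.toList-++ U (fresh m a)))
    (All.++⁺ (All.map (λ u<m → <-≤-trans u<m (m≤m+n m a)) b) (interval-upper m a)))
  (subst (AllPairs _≤_) (sym (Vec.toList-++ U (fresh m a)))
    (AllPairs.++⁺ s (AllPairs.map <⇒≤ (interval-sorted m a))
      (All.map (λ u<m → All.map (≤-trans (<⇒≤ u<m)) (interval-lower m a)) b)))

Pending-weaken : ∀ {U : Vec ℕ d} → m ≤ n → Pending m U → Pending n U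
Pending-weaken m≤n (pending b s) = pending (All.map (λ <m → <-≤-trans <m m≤n) b) s

Pending-high : ∀ {U : Vec ℕ d} → Pending m U → ∀ a → Pending (suc (m + a)) (U Vec.++ fresh m a)
Pending-high P a = Pending-weaken (n≤1+n _) (Pending-++ P a)

-- The entries still to be read, when U is the list of pending values and the
-- values from m on have been neither read nor skipped.
word : Vec ℕ d → ℕ → Walk d → Word
word []      m done       = []
word (u ∷ U) m (low w)    = u ∷ word U m w
word U       m (high a w) = m + a ∷ word (U Vec.++ fresh m a) (suc (m + a)) w

-- The number of values from m on that a walk reads.
supply : Walk d → ℕ
supply done       = 0
supply (low w)    = supply w
supply (high a w) = a + suc (supply w)

word-↭ : ∀ (U : Vec ℕ d) m (w : Walk d) → word U m w ↭ toList U ++ interval m (supply w)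
word-↭ []      m done       = ↭-reflexive refl
word-↭ (u ∷ U) m (low w)    = prep u (word-↭ U m w)
word-↭ U@(_ ∷ _) m (high a w) = begin
  x ∷ word V (suc x) w                                  ↭⟨ prep x (word-↭ V (suc x) w) ⟩
  x ∷ toList V ++ rest                                  ↭⟨ ↭.shift x (toList V) rest ⟨
  toList V ++ x ∷ rest                                  ≡⟨ cong (_++ x ∷ rest) (Vec.toList-++ U (fresh m a)) ⟩
  (toList U ++ interval m a) ++ x ∷ rest                ≡⟨ List.++-assoc (toList U) (interval m a) (x ∷ rest) ⟩
  toList U ++ (interval m a ++ interval x (suc (supply w)))
    ≡⟨ cong (toList U ++_) (interval-++ m a (suc (supply w))) ⟨
  toList U ++ interval m (supply (high a w))            ∎
  where
  open PermutationReasoning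
  x = m + a
  V = U Vec.++ fresh m a
  rest = interval (suc x) (supply w)

-- No entry still to be read is less than the smallest pending value.
word-lower : ∀ {u} {U : Vec ℕ d} → Pending m (u ∷ U) → ∀ w → All (u ≤_) (word U m w)
word-lower {m = m} {U = U} (pending (u<m ∷ _) (u≤U ∷ _)) w = ↭.All-resp-↭ (↭-sym (word-↭ U m w))
  (All.++⁺ u≤U (All.map (≤-trans (<⇒≤ u<m)) (interval-lower m _)))

-- Inversions

-- Inversions grouped by their left entry.
inversionCount : Word → ℕ
inversionCount []       = 0
inversionCount (x ∷ xs) = length (filter (_<? x) xs) + inversionCount xs

word-inversionCount : {U : Vec ℕ d} → Pending m U → ∀ w → inversionCount (word U m w) ≡ area w
word-inversionCount {U = []} P done = refl
word-inversionCount {m = m} {U = u ∷ U} P (low w) = cong₂ _+_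
  (cong length (List.filter-none (_<? u) (All.map ≤⇒≯ (word-lower P w))))
  (word-inversionCount (Pending-low P) w)
word-inversionCount {m = m} {U = U@(_ ∷ _)} P (high {d} a w) =
  cong₂ _+_ smaller (word-inversionCount (Pending-high P a) w)
  where
  open ≡-Reasoning
  x = m + a
  V = U Vec.++ fresh m a
  rest = interval (suc x) (supply w)

  smaller : length (filter (_<? x) (word V (suc x) w)) ≡ suc d + a
  smaller = begin
    length (filter (_<? x) (word V (suc x) w))
      ≡⟨ ↭.↭-length (↭.filter-↭ (_<? x) (word-↭ V (suc x) w)) ⟩
    length (filter (_<? x) (toList V ++ rest))
      ≡⟨ cong length (List.filter-++ (_<? x) (toList V) rest) ⟩
    length (filter (_<? x) (toList V) ++ filter (_<? x) rest)
      ≡⟨ cong₂ (λ ys zs → length (ys ++ zs))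
           (List.filter-all (_<? x) (bounded (Pending-++ P a)))
           (List.filter-none (_<? x) (All.map (≤⇒≯ ∘ <⇒≤) (interval-lower (suc x) (supply w)))) ⟩
    length (toList V ++ [])  ≡⟨ cong length (List.++-identityʳ (toList V)) ⟩
    length (toList V)        ≡⟨ Vec.length-toList V ⟩
    suc d + a                ∎

length-filter-map : {P : Pred B p} (P? : Decidable P) (f : A → B) → ∀ xs →
  length (filter P? (map f xs)) ≡ length (filter (P? ∘ f) xs)
length-filter-map P? f []       = refl
length-filter-map P? f (x ∷ xs) with P? (f x)
... | yes _ = cong suc (length-filter-map P? f xs)
... | no  _ = length-filter-map P? f xs

length-filter-× : {P : Pred (A × B) p} (P? : Decidable P) → ∀ x xs ys →
  length (filter P? (cartesianProduct (x ∷ xs) ys)) ≡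
  length (filter (P? ∘ (x ,_)) ys) + length (filter P? (cartesianProduct xs ys))
length-filter-× P? x xs ys =
  trans (cong length (List.filter-++ P? (map (x ,_) ys) (cartesianProduct xs ys)))
  (trans (List.length-++ (filter P? (map (x ,_) ys)))
         (cong (_+ length (filter P? (cartesianProduct xs ys))) (length-filter-map P? (x ,_) ys)))

allFin-suc : ∀ n → allFin (suc n) ≡ zero ∷ map suc (allFin n)
allFin-suc n = cong (zero ∷_) (sym (List.map-tabulate id suc))

-- Inversions of x ∷ xs whose left position is not the first one.
inversions-suc : ∀ x xs is → 
  length (filter (inversion? (x ∷ xs)) (cartesianProduct (map suc is) (allFin (suc (length xs))))) ≡
  length (filter (inversion? xs) (cartesianProduct is (allFin (length xs))))
inversions-suc x xs []       = refl
inversions-suc x xs (i ∷ is) = begin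
  count′ (map suc (i ∷ is))
    ≡⟨ length-filter-× (inversion? (x ∷ xs)) (suc i) (map suc is) (allFin (suc len)) ⟩
  length (filter (inversion? (x ∷ xs) ∘ (suc i ,_)) (allFin (suc len))) + count′ (map suc is)
    ≡⟨ cong₂ _+_ at-i (inversions-suc x xs is) ⟩
  length (filter (inversion? xs ∘ (i ,_)) (allFin len)) + count is
    ≡⟨ length-filter-× (inversion? xs) i is (allFin len) ⟨
  count (i ∷ is) ∎
  where
  open ≡-Reasoning
  len = length xs
  count : List (Fin len) → ℕ
  count is = length (filter (inversion? xs) (cartesianProduct is (allFin len)))
  count′ : List (Fin (suc len)) → ℕ
  count′ is = length (filter (inversion? (x ∷ xs)) (cartesianProduct is (allFin (suc len))))

  Q? : Decidable (Inversion (x ∷ xs) ∘ (suc i ,_))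
  Q? = inversion? (x ∷ xs) ∘ (suc i ,_)

  at-i : length (filter Q? (allFin (suc len))) ≡ length (filter (inversion? xs ∘ (i ,_)) (allFin len))
  at-i = begin
    length (filter Q? (allFin (suc len)))      ≡⟨ cong (length ∘ filter Q?) (allFin-suc len) ⟩
    length (filter Q? (map suc (allFin len)))  ≡⟨ length-filter-map Q? suc (allFin len) ⟩
    length (filter (Q? ∘ suc) (allFin len))
      ≡⟨ cong length (List.filter-≐ (Q? ∘ suc) (inversion? xs ∘ (i ,_))
           ((λ { (s<s i<j , lt) → i<j , lt }) , (λ { (i<j , lt) → s<s i<j , lt })) (allFin len)) ⟩
    length (filter (inversion? xs ∘ (i ,_)) (allFin len)) ∎

-- Inversions of x ∷ xs whose left position is the first one.
inversions-zero : ∀ x xs →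
  length (filter (inversion? (x ∷ xs) ∘ (zero ,_)) (allFin (suc (length xs)))) ≡ length (filter (_<? x) xs)
inversions-zero x xs = begin
  length (filter Q? (allFin (suc len)))                           ≡⟨ cong (length ∘ filter Q?) (allFin-suc len) ⟩
  length (filter Q? (map suc (allFin len)))                       ≡⟨ length-filter-map Q? suc (allFin len) ⟩
  length (filter (Q? ∘ suc) (allFin len))
    ≡⟨ cong length (List.filter-≐ (Q? ∘ suc) ((_<? x) ∘ List.lookup xs) (proj₂ , (z<s ,_)) (allFin len)) ⟩
  length (filter ((_<? x) ∘ List.lookup xs) (allFin len))
    ≡⟨ length-filter-map (_<? x) (List.lookup xs) (allFin len) ⟨
  length (filter (_<? x) (map (List.lookup xs) (allFin len)))
    ≡⟨ cong (length ∘ filter (_<? x))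
         (trans (List.map-tabulate id (List.lookup xs)) (List.tabulate-lookup xs)) ⟩
  length (filter (_<? x) xs)                                    ∎
  where
  open ≡-Reasoning
  len = length xs
  Q? : Decidable (Inversion (x ∷ xs) ∘ (zero ,_))
  Q? = inversion? (x ∷ xs) ∘ (zero ,_)

inversions≡inversionCount : ∀ π → inversions π ≡ inversionCount π
inversions≡inversionCount []       = refl
inversions≡inversionCount (x ∷ xs) = begin
  inversions (x ∷ xs)
    ≡⟨ cong (λ ks → length (filter (inversion? (x ∷ xs)) (cartesianProduct ks js)))
         (allFin-suc (length xs)) ⟩
  length (filter (inversion? (x ∷ xs)) (cartesianProduct (zero ∷ map suc is) js))
    ≡⟨ length-filter-× (inversion? (x ∷ xs)) zero (map suc is) js ⟩
  length (filter (inversion? (x ∷ xs) ∘ (zero ,_)) js) +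
  length (filter (inversion? (x ∷ xs)) (cartesianProduct (map suc is) js))
    ≡⟨ cong₂ _+_ (inversions-zero x xs) (inversions-suc x xs is) ⟩
  length (filter (_<? x) xs) + inversions xs
    ≡⟨ cong (length (filter (_<? x) xs) +_) (inversions≡inversionCount xs) ⟩
  inversionCount (x ∷ xs) ∎
  where
  open ≡-Reasoning
  is = allFin (length xs)
  js = allFin (suc (length xs))

-- Avoiding 321

AllPairs-lookup : {R : ℕ → ℕ → Set} {xs : List ℕ} → AllPairs R xs →
  ∀ i j → i Fin.< j → R (List.lookup xs i) (List.lookup xs j)
AllPairs-lookup {xs = _ ∷ xs} (r ∷ _) zero    (suc j) _         = All.lookup r (∈-lookup j)
AllPairs-lookup               (_ ∷ rs) (suc i) (suc j) (s<s i<j) = AllPairs-lookup rs i j i<j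

AllPairs-lookup⁻ : {R : ℕ → ℕ → Set} (xs : List ℕ) →
  (∀ i j → i Fin.< j → R (List.lookup xs i) (List.lookup xs j)) → AllPairs R xs
AllPairs-lookup⁻ {R} xs f =
  subst (AllPairs R) (List.tabulate-lookup xs) (AllPairs.tabulate⁺-< (λ {i} {j} → f i j))

-- The entries of the word that are less than m appear in weakly increasing order.
Ordered : ℕ → Word → Set
Ordered m = AllPairs (λ y z → y < m → y ≤ z)

Ordered-weaken : ∀ {xs} → m ≤ n → Ordered n xs → Ordered m xs
Ordered-weaken m≤n = AllPairs.map (λ y≤z y<m → y≤z (<-≤-trans y<m m≤n))

-- After each entry, the entries that do not exceed it appear in weakly increasing
-- order.  For words without repetition this is avoidance of 321.
Avoids321 : Word → Set
Avoids321 []       = ⊤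
Avoids321 (x ∷ xs) = Ordered (suc x) xs × Avoids321 xs

-- An occurrence of 321, given by its three positions.
Descent₃ : Word → Set
Descent₃ π = ∃[ i ] ∃[ j ] ∃[ k ] i Fin.< j × j Fin.< k ×
  List.lookup π j < List.lookup π i × List.lookup π k < List.lookup π j

τ₃₂₁ : Word
τ₃₂₁ = 3 ∷ 2 ∷ 1 ∷ []

Contains321⇒Descent₃ : ∀ {π} → π Contains τ₃₂₁ → Descent₃ π
Contains321⇒Descent₃ (ι , mono , iso) =
  ι zero , ι (suc zero) , ι (suc (suc zero)) , mono z<s , mono (s<s z<s) ,
  Equivalence.to (iso (suc zero) zero) ≤-refl ,
  Equivalence.to (iso (suc (suc zero)) (suc zero)) ≤-refl

Descent₃⇒Contains321 : ∀ {π} → Descent₃ π → π Contains τ₃₂₁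
Descent₃⇒Contains321 {π} (i , j , k , i<j , j<k , πj<πi , πk<πj) = ι , mono , iso
  where
  ι : Fin 3 → Fin (length π)
  ι zero             = i
  ι (suc zero)       = j
  ι (suc (suc zero)) = k

  mono : ∀ {x y} → x Fin.< y → ι x Fin.< ι y
  mono {zero}           {suc zero}       _ = i<j
  mono {zero}           {suc (suc zero)} _ = <-trans i<j j<k
  mono {suc zero}       {suc (suc zero)} _ = j<k
  mono {suc zero}       {suc zero}       (s<s ())
  mono {suc (suc zero)} {suc zero}       (s<s ())
  mono {suc (suc zero)} {suc (suc zero)} (s<s (s<s ()))

  rises : ∀ {a b c d} → a < b → c < d → a < b ⇔ c < d
  rises a<b c<d = mk⇔ (λ _ → c<d) (λ _ → a<b)

  falls : ∀ {a b c d} → b ≤ a → d ≤ c → a < b ⇔ c < d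
  falls b≤a d≤c = mk⇔ (λ a<b → contradiction a<b (≤⇒≯ b≤a)) (λ c<d → contradiction c<d (≤⇒≯ d≤c))

  πk<πi = <-trans πk<πj πj<πi

  iso : ∀ x y → List.lookup τ₃₂₁ x < List.lookup τ₃₂₁ y ⇔ List.lookup π (ι x) < List.lookup π (ι y)
  iso zero             zero             = falls ≤-refl ≤-refl
  iso zero             (suc zero)       = falls (n≤1+n 2) (<⇒≤ πj<πi)
  iso zero             (suc (suc zero)) = falls (s≤s z≤n) (<⇒≤ πk<πi)
  iso (suc zero)       zero             = rises ≤-refl πj<πi
  iso (suc zero)       (suc zero)       = falls ≤-refl ≤-refl
  iso (suc zero)       (suc (suc zero)) = falls (n≤1+n 1) (<⇒≤ πk<πj)
  iso (suc (suc zero)) zero             = rises (s<s z<s) πk<πi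
  iso (suc (suc zero)) (suc zero)       = rises ≤-refl πk<πj
  iso (suc (suc zero)) (suc (suc zero)) = falls ≤-refl ≤-refl

Avoids321⇒¬Descent₃ : ∀ π → Avoids321 π → ¬ Descent₃ π
Avoids321⇒¬Descent₃ (x ∷ xs) (ord , _) (zero , suc j , suc k , _ , s<s j<k , y<x , z<y) =
  <⇒≱ z<y (AllPairs-lookup ord j k j<k (m<n⇒m<1+n y<x))
Avoids321⇒¬Descent₃ (x ∷ xs) (_ , inc) (suc i , suc j , suc k , s<s i<j , s<s j<k , y<x , z<y) =
  Avoids321⇒¬Descent₃ xs inc (i , j , k , i<j , j<k , y<x , z<y)

¬Descent₃⇒Avoids321 : ∀ {π} → Unique π → ¬ Descent₃ π → Avoids321 π
¬Descent₃⇒Avoids321 {[]}     _         _  = tt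
¬Descent₃⇒Avoids321 {x ∷ xs} (x∉ ∷ u) ¬D =
  AllPairs-lookup⁻ xs (λ j k j<k y≤x → ≮⇒≥ λ z<y →
    ¬D (zero , suc j , suc k , z<s , s<s j<k , ≤∧≢⇒< (≤-pred y≤x) (All.lookup x∉ (∈-lookup j) ∘ sym) , z<y))
  , ¬Descent₃⇒Avoids321 u λ { (i , j , k , i<j , j<k , lts) →
      ¬D (suc i , suc j , suc k , s<s i<j , s<s j<k , lts) }

-- Indecomposability

-- As long as entries remain, one of them is less than m, where m is kept strictly
-- above all entries read.  Started with m = 2 on a permutation, this says that no
-- proper non-empty prefix consists of the smallest values.
Linked : ℕ → Word → Set
Linked m []       = ⊤
Linked m (x ∷ xs) = Any (_< m) (x ∷ xs) × Linked (m ⊔ suc x) xs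

-- If a prefix has all its values below n, while the later ones exist and are at
-- least n, the word is not linked: reading the prefix never lifts the bound above n.
gap⇒¬Linked : ∀ {ρ σ} → All (_< n) ρ → All (n ≤_) σ → σ ≢ [] → m ≤ n → ¬ Linked m (ρ ++ σ)
gap⇒¬Linked {ρ = []} {[]} _ _ σ≢[] _ _ = σ≢[] refl
gap⇒¬Linked {ρ = []} {_ ∷ _} _ n≤σ _ m≤n (below , _) =
  All.All¬⇒¬Any (All.map (λ n≤y y<m → <⇒≱ y<m (≤-trans m≤n n≤y)) n≤σ) below
gap⇒¬Linked {ρ = _ ∷ _} (x<n ∷ ρ<n) n≤σ σ≢[] m≤n (_ , linked) =
  gap⇒¬Linked ρ<n n≤σ σ≢[] (⊔-lub m≤n x<n) linked

IsPermutation⇒bounded : ∀ {π} → IsPermutation π → All (_< suc (length π)) π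
IsPermutation⇒bounded p = ↭.All-resp-↭ (↭-sym (IsPermutation⇒↭interval p)) (interval-upper 1 _)

IsPermutation⇒positive : ∀ {π} → IsPermutation π → All (1 ≤_) π
IsPermutation⇒positive p = ↭.All-resp-↭ (↭-sym (IsPermutation⇒↭interval p)) (interval-lower 1 _)

Linked⇒¬Decomposable : ∀ {π} → Linked 2 π → ¬ Decomposable π
Linked⇒¬Decomposable linked ([] , τ , _ , _ , ρ≢[] , _ , _) = ρ≢[] refl
Linked⇒¬Decomposable linked (ρ@(_ ∷ _) , τ , ρ-perm , τ-perm , _ , τ≢[] , refl) =
  gap⇒¬Linked (IsPermutation⇒bounded ρ-perm)
    (All.map⁺ (All.map (λ 1≤t → ≤-trans (≤-reflexive (+-comm 1 (length ρ))) (+-monoʳ-≤ (length ρ) 1≤t))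
      (IsPermutation⇒positive τ-perm)))
    (map≢[] τ τ≢[]) (s≤s (s≤s z≤n)) linked
  where
  map≢[] : ∀ τ → τ ≢ [] → map (length ρ +_) τ ≢ []
  map≢[] []      τ≢[] _ = τ≢[] refl
  map≢[] (_ ∷ _) _    ()

-- If all members of as and xs satisfy P and no member of bs or ys does, a
-- rearrangement of as ++ bs into xs ++ ys acts on the two parts separately.
↭-separate : {P : Pred A p} (P? : Decidable P) {as bs xs ys : List A} →
  All P as → All (¬_ ∘ P) bs → All P xs → All (¬_ ∘ P) ys →
  as ++ bs ↭ xs ++ ys → as ↭ xs × bs ↭ ys
↭-separate {P = P} P? {as} {bs} {xs} {ys} Pas ¬Pbs Pxs ¬Pys eq =
  subst₂ _↭_ (first Pas ¬Pbs) (first Pxs ¬Pys) (↭.filter-↭ P? eq) ,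
  subst₂ _↭_ (second Pas ¬Pbs) (second Pxs ¬Pys) (↭.filter-↭ (∁? P?) eq)
  where
  first : ∀ {us vs} → All P us → All (¬_ ∘ P) vs → filter P? (us ++ vs) ≡ us
  first {us} {vs} Pus ¬Pvs = trans (List.filter-++ P? us vs)
    (trans (cong₂ _++_ (List.filter-all P? Pus) (List.filter-none P? ¬Pvs)) (List.++-identityʳ us))

  second : ∀ {us vs} → All P us → All (¬_ ∘ P) vs → filter (∁? P?) (us ++ vs) ≡ vs
  second {us} {vs} Pus ¬Pvs = trans (List.filter-++ (∁? P?) us vs)
    (cong₂ _++_ (List.filter-none (∁? P?) (All.map (λ Pu ¬Pu → ¬Pu Pu) Pus)) (List.filter-all (∁? P?) ¬Pvs))

-- A permutation decomposes after a proper non-empty prefix ρ that holds exactly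
-- its values up to c.
gap⇒Decomposable : ∀ {c N ρ σ} → ρ ++ σ ↭ interval 1 N → c ≤ N →
  All (_< suc c) ρ → All (suc c ≤_) σ → ρ ≢ [] → σ ≢ [] → Decomposable (ρ ++ σ)
gap⇒Decomposable {c} {_} {ρ} {σ} perm c≤N ρ≤c c<σ ρ≢[] σ≢[] with m≤n⇒∃[o]m+o≡n c≤N
... | o , refl
  with ↭-separate (_<? suc c) ρ≤c (All.map ≤⇒≯ c<σ) (interval-upper 1 c)
         (All.map ≤⇒≯ (interval-lower (suc c) o))
         (↭-trans perm (↭-reflexive (interval-++ 1 c o)))
... | ρ↭ , σ↭
  with ↭.↭-map-inv (c +_) (↭-trans (↭-reflexive (sym shifted)) (↭-sym σ↭))
  where
  shifted : interval (suc c) o ≡ map (c +_) (interval 1 o)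
  shifted = trans (cong (λ k → interval k o) (+-comm 1 c)) (interval-map c 1 o)
... | τ , refl , ↭τ =
  ρ , τ , ↭interval⇒IsPermutation ρ↭ , ↭interval⇒IsPermutation (↭-sym ↭τ) , ρ≢[] ,
  (λ { refl → σ≢[] refl }) ,
  cong (λ k → ρ ++ map (k +_) τ) (sym (trans (↭.↭-length ρ↭) (length-interval 1 c)))

-- Here ρ is the part already read; if no entry of σ is less than m, then ρ and σ
-- split the permutation into its entries below m and the others.
¬Decomposable⇒Linked-suffix : ∀ {N} ρ σ → ρ ++ σ ↭ interval 1 N → m ≤ suc N →
  All (_< m) ρ → ρ ≢ [] → ¬ Decomposable (ρ ++ σ) → Linked m σ
¬Decomposable⇒Linked-suffix ρ [] _ _ _ _ _ = tt
¬Decomposable⇒Linked-suffix {m = zero} (_ ∷ _) (_ ∷ _) _ _ (() ∷ _) _ _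
¬Decomposable⇒Linked-suffix {m = zero} [] (_ ∷ _) _ _ _ ρ≢[] _ = contradiction refl ρ≢[]
¬Decomposable⇒Linked-suffix {m = m@(suc c)} {N} ρ (x ∷ σ) perm (s≤s c≤N) ρ<m ρ≢[] ¬dec
  with Any.any? (_<? m) (x ∷ σ)
... | no none = contradiction
  (gap⇒Decomposable perm c≤N ρ<m (All.map ≮⇒≥ (All.¬Any⇒All¬ _ none)) ρ≢[] λ ()) ¬dec
... | yes some = some ,
  ¬Decomposable⇒Linked-suffix (ρ ++ [ x ]) σ
    (subst (_↭ interval 1 N) assoc perm)
    (⊔-lub (s≤s c≤N) x≤N)
    (All.++⁺ (All.map (λ y<m → ≤-trans y<m (m≤m⊔n m (suc x))) ρ<m) (m≤n⊔m m (suc x) ∷ []))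
    (λ eq → contradiction (List.++-conicalʳ ρ [ x ] eq) λ ())
    (subst (¬_ ∘ Decomposable) assoc ¬dec)
  where
  assoc : ρ ++ x ∷ σ ≡ (ρ ++ [ x ]) ++ σ
  assoc = sym (List.++-assoc ρ [ x ] σ)
  x≤N : x < suc N
  x≤N = All.lookup (↭.All-resp-↭ (↭-sym perm) (interval-upper 1 N)) (∈-++⁺ʳ ρ (here refl))

Indecomposable⇒Linked : ∀ {π} → IsPermutation π → Indecomposable π → Linked 2 π
Indecomposable⇒Linked {[]} _ (π≢[] , _) = contradiction refl π≢[]
Indecomposable⇒Linked {x ∷ σ} perm (_ , ¬dec) =
  Any.map (λ { refl → ≤-refl }) (↭.∈-resp-↭ (↭-sym perm′) (here refl)) ,
  ¬Decomposable⇒Linked-suffix [ x ] σ perm′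
    (⊔-lub (s≤s (s≤s z≤n)) (All.head (IsPermutation⇒bounded perm)))
    (m≤n⊔m 2 (suc x) ∷ []) (λ ()) ¬dec
  where
  perm′ : x ∷ σ ↭ interval 1 (suc (length σ))
  perm′ = IsPermutation⇒↭interval perm

-- The bijection between walks and words

word-ordered : ∀ {U : Vec ℕ d} → Pending m U → ∀ w → Ordered m (word U m w)
word-ordered {U = []} P done = []
word-ordered {U = _ ∷ _} P (low w) = All.map (λ u≤y _ → u≤y) (word-lower P w) ∷ word-ordered (Pending-low P) w
word-ordered {m = m} {U = U@(_ ∷ _)} P (high a w) =
  All.universal (λ _ x<m → contradiction x<m (≤⇒≯ (m≤m+n m a))) _ ∷
  Ordered-weaken (m≤n⇒m≤1+n (m≤m+n m a)) (word-ordered (Pending-high P a) w)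

word-avoids321 : ∀ {U : Vec ℕ d} → Pending m U → ∀ w → Avoids321 (word U m w)
word-avoids321 {U = []} P done = tt
word-avoids321 {U = _ ∷ _} P (low w) =
  Ordered-weaken (All.head (bounded P)) (word-ordered (Pending-low P) w) ,
  word-avoids321 (Pending-low P) w
word-avoids321 {U = _ ∷ _} P (high a w) =
  word-ordered (Pending-high P a) w , word-avoids321 (Pending-high P a) w

word-linked : ∀ {U : Vec ℕ d} → Pending m U → ∀ w → Linked m (word U m w)
word-linked {U = []} P done = tt
word-linked {m = m} {U = u ∷ U} P (low w) =
  here u<m , subst (λ k → Linked k (word U m w)) (sym (m≥n⇒m⊔n≡m u<m)) (word-linked (Pending-low P) w)
  where u<m = All.head (bounded P)
word-linked {m = m} {U = U@(u ∷ _)} P (high a w) =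
  Any.map (λ { refl → All.head (bounded P) }) (↭.∈-resp-↭ (↭-sym (word-↭ U m (high a w))) (here refl)) ,
  subst (λ k → Linked k (word (U Vec.++ fresh m a) (suc (m + a)) w))
    (sym (m≤n⇒m⊔n≡n (m≤n⇒m≤1+n (m≤m+n m a)))) (word-linked (Pending-high P a) w)

word-injective : ∀ {U : Vec ℕ d} → Pending m U → ∀ w w′ → word U m w ≡ word U m w′ → w ≡ w′
word-injective {U = []}    P done    done     eq = refl
word-injective {U = _ ∷ _} P (low w) (low w′) eq =
  cong low (word-injective (Pending-low P) w w′ (List.∷-injectiveʳ eq))
word-injective {m = m} {U = _ ∷ _} P (low w) (high a w′) eq =
  contradiction (All.head (bounded P)) (≤⇒≯ (≤-trans (m≤m+n m a) (≤-reflexive (sym (List.∷-injectiveˡ eq)))))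
word-injective {m = m} {U = _ ∷ _} P (high a w) (low w′) eq =
  contradiction (All.head (bounded P)) (≤⇒≯ (≤-trans (m≤m+n m a) (≤-reflexive (List.∷-injectiveˡ eq))))
word-injective {m = m} {U = _ ∷ _} P (high a w) (high b w′) eq with +-cancelˡ-≡ m a b (List.∷-injectiveˡ eq)
... | refl = cong (high a) (word-injective (Pending-high P a) w w′ (List.∷-injectiveʳ eq))

-- The walk is read off the word: an entry less than m must be the smallest pending
-- value, because the pending values occur in increasing order, and any other entry
-- is a new maximum.
word-surjective : ∀ σ {U : Vec ℕ d} {m} n → Pending m U → σ ↭ toList U ++ interval m n →
  Ordered m σ → Avoids321 σ → Linked m σ → Σ[ w ∈ Walk d ] word U m w ≡ σ
word-surjective [] {[]} n P perm ord inc linked = done , refl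
word-surjective [] {u ∷ U} n P perm ord inc linked = contradiction (↭-sym perm) ↭.¬x∷xs↭[]
word-surjective (x ∷ σ) {[]} {m} n P perm ord inc (below , _) = contradiction below
  (All.All¬⇒¬Any (All.map ≤⇒≯ (↭.All-resp-↭ (↭-sym perm) (interval-lower m n))))
word-surjective (x ∷ σ) {U@(u ∷ U′)} {m} n P perm (x≤σ ∷ ord) (inc , incs) (_ , linked) with x <? m
... | yes x<m = low-first
  where
  x≤u : x ≤ u
  x≤u with ↭.∈-resp-↭ (↭-sym perm) (here refl)
  ... | here refl = ≤-refl
  ... | there u∈σ = All.lookup x≤σ u∈σ x<m

  u≤x : u ≤ x
  u≤x with ∈-++⁻ (toList U) (↭.∈-resp-↭ perm (here refl))
  ... | inj₁ (here refl) = ≤-refl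
  ... | inj₁ (there x∈U′) = All.lookup (AllPairs.head (sorted P)) x∈U′
  ... | inj₂ x∈interval = contradiction x<m (≤⇒≯ (All.lookup (interval-lower m n) x∈interval))

  low-first : Σ[ w ∈ Walk _ ] word U m w ≡ x ∷ σ
  low-first with ≤-antisym x≤u u≤x
  ... | refl with word-surjective σ n (Pending-low P) (↭.drop-∷ perm) ord incs
                   (subst (λ k → Linked k σ) (m≥n⇒m⊔n≡m x<m) linked)
  ... | w , eq = low w , cong (x ∷_) eq
... | no x≮m with ∈-++⁻ (toList U) (↭.∈-resp-↭ perm (here refl))
... | inj₁ x∈U = contradiction (All.lookup (bounded P) x∈U) x≮m
... | inj₂ x∈interval with ∈-interval⁻ m n x∈interval
... | a , b , refl , refl with word-surjective σ b (Pending-high P a)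
        (↭.drop-mid [] (toList (U Vec.++ fresh m a)) (↭-trans perm (↭-reflexive split)))
        inc incs (subst (λ k → Linked k σ) (m≤n⇒m⊔n≡n (m≤n⇒m≤1+n (m≤m+n m a))) linked)
  where
  open ≡-Reasoning
  split : toList U ++ interval m (a + suc b) ≡
          toList (U Vec.++ fresh m a) ++ (m + a) ∷ interval (suc (m + a)) b
  split = begin
    toList U ++ interval m (a + suc b)                        ≡⟨ cong (toList U ++_) (interval-++ m a (suc b)) ⟩
    toList U ++ interval m a ++ interval (m + a) (suc b)      ≡⟨ List.++-assoc (toList U) _ _ ⟨
    (toList U ++ interval m a) ++ interval (m + a) (suc b)
      ≡⟨ cong (_++ interval (m + a) (suc b)) (Vec.toList-++ U (fresh m a)) ⟨
    toList (U Vec.++ fresh m a) ++ interval (m + a) (suc b)   ∎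
... | w , eq = high a w , cong (m + a ∷_) eq

-- Before the first entry is read, the value 1 is regarded as pending.  This lets
-- a permutation of length at least 2 begin with a new maximum like any other,
-- while the permutation 1 reads the pending value and stops.
one-pending : Pending 2 (1 ∷ [])
one-pending = pending (≤-refl ∷ []) ([] ∷ [])

-- The permutation whose history a walk is.
permutation : Walk 1 → Word
permutation = word (1 ∷ []) 2

permutation-IsPermutation : ∀ w → IsPermutation (permutation w)
permutation-IsPermutation w = ↭interval⇒IsPermutation {n = suc (supply w)} (word-↭ (1 ∷ []) 2 w)

permutation-nonempty : ∀ w → permutation w ≢ []
permutation-nonempty (low w)    ()
permutation-nonempty (high a w) ()

IsPermutation⇒Ordered : ∀ {π} → IsPermutation π → Ordered 2 π
IsPermutation⇒Ordered perm = go (IsPermutation⇒positive perm)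
  where
  go : ∀ {π} → All (1 ≤_) π → Ordered 2 π
  go []          = []
  go (1≤y ∷ 1≤π) = All.map (λ 1≤z y<2 → ≤-trans (≤-pred y<2) 1≤z) 1≤π ∷ go 1≤π

IsPermutation⇒Unique : ∀ {π} → IsPermutation π → Unique π
IsPermutation⇒Unique {π} perm = ↭ₛ.Unique-resp-↭ (setoid ℕ) (↭⇒↭ₛ (↭-sym (IsPermutation⇒↭interval perm)))
  (AllPairs.map <⇒≢ (interval-sorted 1 (length π)))

permutations-finite : ∀ {N} k → WalkOfArea 1 k HasSize N → I k (τ₃₂₁ ∷ []) HasSize N
permutations-finite k = HasSize-bijection permutation to
  (λ w w′ _ _ → word-injective one-pending w w′) surjective
  where
  area≡inversions : ∀ w → inversions (permutation w) ≡ area w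
  area≡inversions w = trans (inversions≡inversionCount (permutation w)) (word-inversionCount one-pending w)

  to : ∀ w → WalkOfArea 1 k w → I k (τ₃₂₁ ∷ []) (permutation w)
  to w refl =
    permutation-IsPermutation w ,
    (permutation-nonempty w , Linked⇒¬Decomposable (word-linked one-pending w)) ,
    area≡inversions w ,
    Avoids321⇒¬Descent₃ (permutation w) (word-avoids321 one-pending w) ∘
      Contains321⇒Descent₃ {permutation w} ∷ []

  surjective : ∀ π → I k (τ₃₂₁ ∷ []) π → Σ[ w ∈ Walk 1 ] WalkOfArea 1 k w × permutation w ≡ π
  surjective [] (_ , (π≢[] , _) , _) = contradiction refl π≢[]
  surjective π@(_ ∷ σ) (perm , indec , inv≡k , avoids ∷ [])
    with word-surjective π (length σ) one-pending (IsPermutation⇒↭interval perm) (IsPermutation⇒Ordered perm)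
           (¬Descent₃⇒Avoids321 (IsPermutation⇒Unique perm) (avoids ∘ Descent₃⇒Contains321 {π}))
           (Indecomposable⇒Linked perm indec)
  ... | w , eq = w , trans (sym (area≡inversions w)) (trans (cong inversions eq) inv≡k) , eq

theorem5 : (k : ℕ) → k ≥ 1 →
    ∃[ N ] (I k ((3 ∷ 2 ∷ 1 ∷ []) ∷ []) HasSize N) × (ParallelogramPolyomino k HasSize N)
theorem5 k k≥1 with walksOfArea-finite 1 k
... | N , size = N , permutations-finite k size , polyominoes-finite k k≥1 size
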